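{- Let $G$ be a graph of order $n$ and let $\overline{G}$ be its complement. Then $a(G) + a(\overline{G}) \leq n + 4$, and this bound is sharp, i.e., there exist graphs for which equality holds.
   Context: All graphs are finite and simple. $a(G)$ denotes the maximum number of vertices of an induced subgraph of $G$ that is a forest (acyclic). -}

module Defs where

open import Data.Nat using (ℕ; zero; suc; _≤_; _≥_; _≡ᵇ_)
open import Data.Fin using (Fin; toℕ)
open import Data.Fin.Subset using (Subset; _∈_; ∣_∣)
open import Data.Bool using (Bool; true; false; not; _∧_)
open import Data.Bool.Properties using (∧-zeroʳ)
open import Data.List using (List; []; _∷_; length; _++_)
open import Data.List.Relation.Unary.All using (All)
open import Data.List.Relation.Unary.Unique.Propositional using (Unique)
open import Data.List.Relation.Unary.Linked using (Linked)
open import Data.Product using (Σ; _×_; ∃)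
open import Relation.Binary.PropositionalEquality using (_≡_; refl; cong₂)
open import Relation.Nullary using (¬_)

record Graph (n : ℕ) : Set where
  field
    adj   : Fin n → Fin n → Bool
    sym   : ∀ u v → adj u v ≡ adj v u
    irrefl : ∀ v → adj v v ≡ false
open Graph public

Adj : ∀ {n} → Graph n → Fin n → Fin n → Set
Adj G u v = adj G u v ≡ true

private
  eqᵇ : ∀ {n} → Fin n → Fin n → Bool
  eqᵇ u v = toℕ u ≡ᵇ toℕ v

  ≡ᵇ-sym : ∀ (a b : ℕ) → (a ≡ᵇ b) ≡ (b ≡ᵇ a)
  ≡ᵇ-sym zero zero = refl
  ≡ᵇ-sym zero (suc b) = refl
  ≡ᵇ-sym (suc a) zero = refl
  ≡ᵇ-sym (suc a) (suc b) = ≡ᵇ-sym a b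

  ≡ᵇ-refl : ∀ (a : ℕ) → (a ≡ᵇ a) ≡ true
  ≡ᵇ-refl zero = refl
  ≡ᵇ-refl (suc a) = ≡ᵇ-refl a

  cadj : ∀ {n} → Graph n → Fin n → Fin n → Bool
  cadj G u v = not (adj G u v) ∧ not (eqᵇ u v)

  csym : ∀ {n} (G : Graph n) u v → cadj G u v ≡ cadj G v u
  csym G u v = cong₂ (λ x y → not x ∧ not y) (Graph.sym G u v) (≡ᵇ-sym (toℕ u) (toℕ v))

  cirr : ∀ {n} (G : Graph n) v → cadj G v v ≡ false
  cirr G v rewrite ≡ᵇ-refl (toℕ v) = ∧-zeroʳ (not (adj G v v))

complement : ∀ {n} → Graph n → Graph n
complement G = record { adj = cadj G ; sym = csym G ; irrefl = cirr G }

record CycleIn {n : ℕ} (G : Graph n) (S : Subset n) : Set where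
  field
    first    : Fin n
    rest     : List (Fin n)
    last     : Fin n
    longEnough : length rest ≥ 1
    inS      : All (_∈ S) (first ∷ rest ++ (last ∷ []))
    distinct : Unique (first ∷ rest ++ (last ∷ []))
    path     : Linked (Adj G) (first ∷ rest ++ (last ∷ []))
    closing  : Adj G last first

InducedForest : ∀ {n} → Graph n → Subset n → Set
InducedForest G S = ¬ CycleIn G S

IsForestNumber : ∀ {n} → Graph n → ℕ → Set
IsForestNumber {n} G k =
  (Σ (Subset n) λ S → InducedForest G S × ∣ S ∣ ≡ k)
  × (∀ (S : Subset n) → InducedForest G S → ∣ S ∣ ≤ k)

{-# OPTIONS --safe #-}
-- If S induces a forest in G and T induces one in the complement, then S ∩ T does both, and
-- every 5-vertex graph or its complement contains a cycle, so ∣ S ∩ T ∣ ≤ 4 and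
-- ∣ S ∣ + ∣ T ∣ = ∣ S ∪ T ∣ + ∣ S ∩ T ∣ ≤ n + 4.  The claim on five vertices is decided by running
-- through all 2¹⁰ labelled graphs.  Equality holds for the path on four vertices, which is a forest
-- and is isomorphic to its complement.
module Submission where

open import Defs
open import Data.Nat using (ℕ; zero; suc; _+_; _≤_; _<_; _≤?_; z≤n; s≤s; s≤s⁻¹)
open import Data.Nat.Properties
  using (≡ᵇ⇒≡; ≡⇒≡ᵇ; ≤-trans; +-monoʳ-≤; +-suc; ≰⇒>; m≤n⇒m≤1+n; +-comm)
import Data.Nat as ℕ
open import Data.Fin using (Fin; zero; suc; toℕ; fromℕ<; inject≤)
open import Data.Fin.Properties
  using (_≟_; any?; toℕ-injective; toℕ-fromℕ<; suc-injective; inject≤-injective; injective⇒≤)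
open import Data.Fin.Subset using (Subset; inside; outside; _∈_; _∩_; ∣_∣; ⊤)
open import Data.Fin.Subset.Properties
  using (anySubset?; x∈p∩q⁻; ∣p∣≤n; ∣⊤∣≡n)
open import Data.Bool using (Bool; true; false; not; _∧_)
import Data.Bool.Properties as Bool
open import Data.Bool.Properties using (T-≡)
import Data.List as List
open import Data.List using (List; []; _∷_; length; _++_; map)
open import Data.List.Properties using (length-++; length-map; map-++)
open import Data.List.Relation.Unary.All using (All; universal)
import Data.List.Relation.Unary.All as All
import Data.List.Relation.Unary.All.Properties as All
open import Data.List.Membership.Propositional.Properties using (∈-lookup)
open import Data.List.Relation.Unary.Linked using (Linked; linked?)
import Data.List.Relation.Unary.Linked as Linked
import Data.List.Relation.Unary.Linked.Properties as Linked
open import Data.List.Relation.Unary.Unique.Propositional using (Unique)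
open import Data.List.Relation.Unary.AllPairs using (_∷_)
import Data.List.Relation.Unary.Unique.Propositional.Properties as Unique
import Data.List.Relation.Unary.Unique.DecPropositional as DecUnique
open import Data.Product using (Σ; ∃; ∃-syntax; _×_; _,_; proj₁; proj₂)
open import Data.Sum using (_⊎_; inj₁; inj₂)
open import Data.Unit using (tt)
import Data.Unit as Unit
open import Data.Vec using ([]; _∷_; lookup; tabulate; here; there)
open import Data.Vec.Properties using (lookup∘tabulate)
open import Function using (_∘_; Injective; Equivalence; mk⇔)
open import Relation.Nullary using (Dec; yes; no; contradiction)
open import Relation.Nullary.Decidable
  using (map′; _×-dec_; _⊎-dec_; ¬?; decidable-stable; from-yes; from-no)
open import Relation.Unary using (Pred; Decidable)
open import Relation.Binary.PropositionalEquality
  using (_≡_; refl; trans; cong; cong₂; subst) renaming (sym to ≡-sym)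

-- k is the number of vertices other than u and v, as in CycleIn; the cycle has length k + 2.
Cycle : ∀ {n} → Graph n → ℕ → Set
Cycle G k =
  ∃[ u ] ∃[ v ] (Adj G v u × ∃[ xs ] (length xs ≡ k
    × Linked (Adj G) (u ∷ xs ++ v ∷ []) × Unique (u ∷ xs ++ v ∷ [])))

-- Only finitely many lists over `Fin n` have a given length, so the search recurses on the length
-- and tries every head.
anyList? : ∀ {n p} {P : Pred (List (Fin n)) p} → Decidable P →
           ∀ k → Dec (∃[ xs ] (length xs ≡ k × P xs))
anyList? P? zero = map′ (λ p → [] , refl , p) (λ { ([] , _ , p) → p }) (P? [])
anyList? P? (suc k) =
  map′ (λ { (x , xs , eq , p) → x ∷ xs , cong suc eq , p })
       (λ { (x ∷ xs , refl , p) → x , xs , refl , p })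
       (any? λ x → anyList? (P? ∘ (x ∷_)) k)

cycle? : ∀ {n} (G : Graph n) k → Dec (Cycle G k)
cycle? {n} G k =
  any? λ u → any? λ v → adj? v u ×-dec
    anyList? (λ xs → linked? adj? (u ∷ xs ++ v ∷ []) ×-dec
                     DecUnique.unique? _≟_ (u ∷ xs ++ v ∷ [])) k
  where
  adj? : ∀ u v → Dec (Adj G u v)
  adj? u v = adj G u v Bool.≟ true

-- Adjacency agrees as a Boolean, so non-edges are kept as well: the image is an induced copy, and
-- the same map embeds the complements.
record Embedding {m n} (H : Graph m) (G : Graph n) : Set where
  field
    to        : Fin m → Fin n
    injective : Injective _≡_ _≡_ to
    adj-to    : ∀ u v → adj H u v ≡ adj G (to u) (to v)

open Embedding

-- Adjacency in a complement tests equality of vertices by `≡ᵇ` on `toℕ`, so an embedding must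
-- preserve this test; injectivity gives the direction from the images back.
≡ᵇ-injective : ∀ {m n} {f : Fin m → Fin n} → Injective _≡_ _≡_ f →
               ∀ u v → (toℕ u ℕ.≡ᵇ toℕ v) ≡ (toℕ (f u) ℕ.≡ᵇ toℕ (f v))
≡ᵇ-injective {f = f} inj u v = Bool.⇔→≡ {z = true} (mk⇔
  (T-≡ .to ∘ ≡⇒≡ᵇ _ _ ∘ cong (toℕ ∘ f) ∘ toℕ-injective ∘ ≡ᵇ⇒≡ _ _ ∘ T-≡ .from)
  (T-≡ .to ∘ ≡⇒≡ᵇ _ _ ∘ cong toℕ ∘ inj ∘ toℕ-injective ∘ ≡ᵇ⇒≡ _ _ ∘ T-≡ .from))
  where open Equivalence using (to; from)

complement-embedding : ∀ {m n} {H : Graph m} {G : Graph n} →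
                       Embedding H G → Embedding (complement H) (complement G)
complement-embedding e .to = e .to
complement-embedding e .injective = e .injective
complement-embedding e .adj-to u v =
  cong₂ (λ a b → not a ∧ not b) (e .adj-to u v) (≡ᵇ-injective (e .injective) u v)

-- The walk, its distinctness and its closing edge are carried over vertex by vertex; `suc k`
-- supplies the inner vertex that `longEnough` asks for.
cycle-embedding : ∀ {m n k} {H : Graph m} {G : Graph n} {S : Subset n} (e : Embedding H G) →
                  (∀ i → e .to i ∈ S) → Cycle H (suc k) → CycleIn G S
cycle-embedding {H = H} {G} {S} e into (u , v , vu , xs , len , path , distinct) = record
  { first      = f u
  ; rest       = map f xs
  ; last       = f v
  ; longEnough = subst (1 ≤_) (≡-sym (trans (length-map f xs) len)) (s≤s z≤n)
  ; inS        = subst (All (_∈ S)) map-walk (All.map⁺ (universal into (u ∷ xs ++ v ∷ [])))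
  ; distinct   = subst Unique map-walk (Unique.map⁺ (e .injective) distinct)
  ; path       = subst (Linked (Adj G)) map-walk (Linked.map⁺ (Linked.map adj⁺ path))
  ; closing    = adj⁺ vu
  }
  where
  f = e .to
  adj⁺ : ∀ {u v} → Adj H u v → Adj G (f u) (f v)
  adj⁺ {u} {v} = trans (≡-sym (e .adj-to u v))
  map-walk : map f (u ∷ xs ++ v ∷ []) ≡ f u ∷ map f xs ++ f v ∷ []
  map-walk = cong (f u ∷_) (map-++ f xs (v ∷ []))

-- The strict upper triangle of an adjacency matrix, row by row.
Code : ℕ → Set
Code zero    = Unit.⊤
Code (suc n) = Subset n × Code n

anyCode? : ∀ {n p} {P : Pred (Code n) p} → Decidable P → Dec (∃ P)
anyCode? {zero}  P? = map′ (tt ,_) proj₂ (P? tt)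
anyCode? {suc n} P? =
  map′ (λ { (s , c , p) → (s , c) , p }) (λ { ((s , c) , p) → s , c , p })
       (anySubset? λ s → anyCode? λ c → P? (s , c))

allCodes? : ∀ {n p} {P : Pred (Code n) p} → Decidable P → Dec (∀ c → P c)
allCodes? P? =
  -- The search is for a counterexample; if there is none, decidability of `P` removes the double
  -- negation.
  map′ (λ none c → decidable-stable (P? c) (λ ¬p → none (c , ¬p)))
       (λ all (c , ¬p) → ¬p (all c))
       (¬? (anyCode? (¬? ∘ P?)))

decode : ∀ {n} → Code n → Graph n
decode {n} c = record { adj = entry c ; sym = entry-sym c ; irrefl = entry-irrefl c }
  where
  entry : ∀ {n} → Code n → Fin n → Fin n → Bool
  entry (s , c) zero    zero    = false
  entry (s , c) zero    (suc j) = lookup s j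
  entry (s , c) (suc i) zero    = lookup s i
  entry (s , c) (suc i) (suc j) = entry c i j

  entry-sym : ∀ {n} (c : Code n) i j → entry c i j ≡ entry c j i
  entry-sym (s , c) zero    zero    = refl
  entry-sym (s , c) zero    (suc j) = refl
  entry-sym (s , c) (suc i) zero    = refl
  entry-sym (s , c) (suc i) (suc j) = entry-sym c i j

  entry-irrefl : ∀ {n} (c : Code n) i → entry c i i ≡ false
  entry-irrefl (s , c) zero    = refl
  entry-irrefl (s , c) (suc i) = entry-irrefl c i

pullback : ∀ {m n} → (Fin m → Fin n) → Graph n → Graph m
pullback f G = record
  { adj    = λ u v → adj G (f u) (f v)
  ; sym    = λ u v → Graph.sym G (f u) (f v)
  ; irrefl = λ v → irrefl G (f v)
  }

encode : ∀ {n} → Graph n → Code n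
encode {zero}  G = tt
encode {suc n} G = tabulate (λ j → adj G zero (suc j)) , encode (pullback suc G)

-- Pointwise agreement is what `adj-to` asks for. The diagonal comes from irreflexivity, the lower
-- triangle from symmetry.
decode-encode : ∀ {n} (G : Graph n) u v → adj (decode (encode G)) u v ≡ adj G u v
decode-encode {suc n} G zero    zero    = ≡-sym (irrefl G zero)
decode-encode {suc n} G zero    (suc v) = lookup∘tabulate _ v
decode-encode {suc n} G (suc u) zero    =
  trans (lookup∘tabulate _ u) (Graph.sym G zero (suc u))
decode-encode {suc n} G (suc u) (suc v) = decode-encode (pullback suc G) u v

-- Two forests on five vertices have at most 4 + 4 edges, but a graph and its complement share 10.
-- The three values of `k` stand for the cycle lengths 3, 4 and 5.
cycle-on-five : ∀ (c : Code 5) → ∃[ k ]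
  (Cycle (decode c) (suc (toℕ {3} k)) ⊎ Cycle (complement (decode c)) (suc (toℕ k)))
cycle-on-five = from-yes (allCodes? {5} λ c → any? {3} λ k →
  cycle? (decode c) (suc (toℕ k)) ⊎-dec cycle? (complement (decode c)) (suc (toℕ k)))

element : ∀ {n} (p : Subset n) → Fin ∣ p ∣ → Fin n
element (inside  ∷ p) zero    = zero
element (inside  ∷ p) (suc i) = suc (element p i)
element (outside ∷ p) i       = suc (element p i)

element-∈ : ∀ {n} (p : Subset n) i → element p i ∈ p
element-∈ (inside  ∷ p) zero    = here
element-∈ (inside  ∷ p) (suc i) = there (element-∈ p i)
element-∈ (outside ∷ p) i       = there (element-∈ p i)

element-injective : ∀ {n} (p : Subset n) → Injective _≡_ _≡_ (element p)
element-injective (inside  ∷ p) {zero}  {zero}  eq = refl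
element-injective (inside  ∷ p) {suc i} {suc j} eq =
  cong suc (element-injective p (suc-injective eq))
element-injective (outside ∷ p) eq = element-injective p (suc-injective eq)

common-forest-≤4 : ∀ {n} (G : Graph n) (S T : Subset n) →
  InducedForest G S → InducedForest (complement G) T → ∣ S ∩ T ∣ ≤ 4
common-forest-≤4 G S T forestS forestT with ∣ S ∩ T ∣ ≤? 4
... | yes ≤4 = ≤4
... | no  ≰4 = contradiction (cycle-on-five code) λ where
    (k , inj₁ cycle) → forestS (cycle-embedding e (proj₁ ∘ into) cycle)
    (k , inj₂ cycle) → forestT (cycle-embedding (complement-embedding e) (proj₂ ∘ into) cycle)
  where
  5≤ : 5 ≤ ∣ S ∩ T ∣
  5≤ = ≰⇒> ≰4
  f : Fin 5 → Fin _
  f i = element (S ∩ T) (inject≤ i 5≤)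
  into : ∀ i → f i ∈ S × f i ∈ T
  into i = x∈p∩q⁻ S T (element-∈ (S ∩ T) (inject≤ i 5≤))
  code : Code 5
  code = encode (pullback f G)
  -- The source is the decoded code, as `cycle-on-five` speaks of codes; it agrees pointwise with
  -- the graph induced on the five chosen vertices.
  e : Embedding (decode code) G
  e = record
    { to        = f
    ; injective = inject≤-injective 5≤ 5≤ _ _ ∘ element-injective (S ∩ T)
    ; adj-to    = decode-encode (pullback f G)
    }

-- Inclusion-exclusion with the size of the union bounded by `n`, one coordinate at a time; the
-- slack comes from coordinates outside both sets.
∣p∣+∣q∣≤n+∣p∩q∣ : ∀ {n} (p q : Subset n) → ∣ p ∣ + ∣ q ∣ ≤ n + ∣ p ∩ q ∣
∣p∣+∣q∣≤n+∣p∩q∣ []            []            = z≤n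
∣p∣+∣q∣≤n+∣p∩q∣ {suc n} (inside  ∷ p) (inside  ∷ q)
  rewrite +-suc ∣ p ∣ ∣ q ∣ | +-suc n ∣ p ∩ q ∣ = s≤s (s≤s (∣p∣+∣q∣≤n+∣p∩q∣ p q))
∣p∣+∣q∣≤n+∣p∩q∣ (inside  ∷ p) (outside ∷ q) = s≤s (∣p∣+∣q∣≤n+∣p∩q∣ p q)
∣p∣+∣q∣≤n+∣p∩q∣ (outside ∷ p) (inside  ∷ q)
  rewrite +-suc ∣ p ∣ ∣ q ∣ = s≤s (∣p∣+∣q∣≤n+∣p∩q∣ p q)
∣p∣+∣q∣≤n+∣p∩q∣ (outside ∷ p) (outside ∷ q) = m≤n⇒m≤1+n (∣p∣+∣q∣≤n+∣p∩q∣ p q)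

lookup-injective : ∀ {a} {A : Set a} {xs : List A} → Unique xs →
                   Injective _≡_ _≡_ (List.lookup xs)
lookup-injective (x≢ ∷ distinct) {zero}  {zero}  eq = refl
lookup-injective (x≢ ∷ distinct) {zero}  {suc j} eq = contradiction eq (All.lookup x≢ (∈-lookup j))
lookup-injective (x≢ ∷ distinct) {suc i} {zero}  eq =
  contradiction (≡-sym eq) (All.lookup x≢ (∈-lookup i))
lookup-injective (x≢ ∷ distinct) {suc i} {suc j} eq = cong suc (lookup-injective distinct eq)

-- Pigeonhole: positions of a duplicate-free list inject into `Fin n`.
unique-length≤n : ∀ {n} {xs : List (Fin n)} → Unique xs → length xs ≤ n
unique-length≤n distinct = injective⇒≤ (lookup-injective distinct)

-- `CycleIn` puts no explicit bound on the length, but distinctness leaves at most `n` vertices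
-- between the two ends. Being a forest thus becomes a finite check.
cycle-bounded : ∀ {n} {G : Graph (2 + n)} {S : Subset (2 + n)} → CycleIn G S →
                ∃[ k ] Cycle G (suc (toℕ {n} k))
-- An empty `rest` is excluded by `longEnough`.
cycle-bounded {n} {G} record { first = u ; rest = x ∷ xs ; last = v
                             ; distinct = distinct ; path = path ; closing = closing } =
  fromℕ< short , u , v , closing , x ∷ xs , cong suc (≡-sym (toℕ-fromℕ< short)) , path , distinct
  where
  short : length xs < n
  short = s≤s⁻¹ (s≤s⁻¹ (subst (_≤ 2 + n)
    (cong (2 +_) (trans (length-++ xs) (+-comm (length xs) 1))) (unique-length≤n distinct)))

P₄ : Graph 4
-- Each row lists adjacency to the later vertices only, so the edges are 0-1, 1-2 and 2-3.
P₄ = decode (e ∷ o ∷ o ∷ [] , e ∷ o ∷ [] , e ∷ [] , [] , tt)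
  where
  e = inside
  o = outside

⊤-forestNumber : ∀ {n} {G : Graph n} → InducedForest G ⊤ → IsForestNumber G n
⊤-forestNumber {n} forest = (⊤ , forest , ∣⊤∣≡n n) , λ S _ → ∣p∣≤n S

-- On four vertices only triangles and 4-cycles have to be ruled out.
P₄-forest : InducedForest P₄ ⊤
P₄-forest = from-no (any? λ k → cycle? P₄ (suc (toℕ {2} k))) ∘ cycle-bounded

co-P₄-forest : InducedForest (complement P₄) ⊤
co-P₄-forest = from-no (any? λ k → cycle? (complement P₄) (suc (toℕ {2} k))) ∘ cycle-bounded

theorem3 : (∀ (n : ℕ) (G : Graph n) (a ā : ℕ) →
    IsForestNumber G a → IsForestNumber (complement G) ā → a + ā ≤ n + 4)
    × (Σ ℕ λ n → Σ (Graph n) λ G → Σ ℕ λ a → Σ ℕ λ ā →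
    IsForestNumber G a × IsForestNumber (complement G) ā × a + ā ≡ n + 4)
theorem3 = bound , 4 , P₄ , 4 , 4 , ⊤-forestNumber P₄-forest , ⊤-forestNumber co-P₄-forest , refl
  where
  bound : ∀ n (G : Graph n) a ā →
          IsForestNumber G a → IsForestNumber (complement G) ā → a + ā ≤ n + 4
  bound n G a ā ((S , forestS , refl) , _) ((T , forestT , refl) , _) =
    ≤-trans (∣p∣+∣q∣≤n+∣p∩q∣ S T) (+-monoʳ-≤ n (common-forest-≤4 G S T forestS forestT))
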